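{- Let $a,b,c$ be positive integers with $c\ge 2$ and $\gcd(b,c)=1$. For every integer $l$ with $1\le l\le c-1$ there exists a unique $a$-reduced set of integers $\{j_i^{(l)}\}_{i=1}^{k_l}$, for some positive integer $k_l$, such that $$l=\sum_{i=1}^{k_l}j_i^{(l)}\cdot s_i(a).$$ Moreover, define $x_0:=0$ and $x_l:=\sum_{i=1}^{k_l}j_i^{(l)}\cdot t_i(a,b,c)$ for $1\le l\le c-1$. Then the following hold: (1) for every integer $l$ with $0\le l\le c-1$, $x_l=\min\{x\in G_{a,b}(c): x\equiv bl \pmod c\}$; (2) $\operatorname{Ap}(G_{a,b}(c),c)=\{x_l: 0\le l\le c-1\}$; (3) $F(G_{a,b}(c))=x_{c-1}-c$; (4) $g(G_{a,b}(c))=\frac{1}{c}\cdot\sum_{l=1}^{c-1}x_l-\frac{c-1}{2}$.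
   Context: $\mathbb{N}$ denotes the set of non-negative integers (including $0$). For positive integers $a,b$ let $\theta_{a,b}:\mathbb{N}\to\mathbb{N}$, $x\mapsto ax+b$. A subsemigroup $G$ of $(\mathbb{N},+)$ containing $0$ is called a $\theta_{a,b}$-semigroup if $\theta_{a,b}(y)\in G$ for every $y\in G\setminus\{0\}$. $G_{a,b}(c)$ denotes the smallest (with respect to inclusion) $\theta_{a,b}$-semigroup containing $c$; under the stated hypotheses it is a numerical semigroup, i.e. a subsemigroup of $(\mathbb{N},+)$ containing $0$ with finite complement in $\mathbb{N}$. For $k\in\mathbb{N}$ set $s_0(a)=0$ and $s_k(a)=\sum_{i=0}^{k-1}a^i$ for $k\ge 1$, and $t_k(a,b,c)=a^kc+b\cdot s_k(a)$. A family $\{j_i\}_{i=1}^{k}$ of non-negative integers ($k\ge 1$) is called $a$-reduced if: $0\le j_i\le a$ for all $1\le i\le k$; $j_k\ne 0$; and whenever $j_m=a$ for some $1\le m\le k$, then $j_i=0$ for all $1\le i<m$. Two such families are equal if they have the same index set and the same entries. For a numerical semigroup $G$: $g(G)=|\mathbb{N}\setminus G|$ is the genus; $F(G)=\max\{x: x\in\mathbb{Z}\setminus G\}$ is the Frobenius number; and for $n\in G\setminus\{0\}$, $\operatorname{Ap}(G,n)=\{s\in G: s-n\notin G\}$ is the Apéry set. -}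

module Defs where

open import Data.Fin using (Fin; toℕ) renaming (_<_ to _<ᶠ_)
open import Data.Integer using (ℤ; +_)
import Data.Integer as ℤ
import Data.Integer.Divisibility as ℤ
open import Data.List using (List; length)
open import Data.List.Membership.Propositional using () renaming (_∈_ to _∈ˡ_)
open import Data.List.Relation.Unary.Unique.Propositional using (Unique)
open import Data.Nat using (ℕ; zero; suc; _+_; _*_; _^_; _≤_)
open import Data.Nat.Properties using (+-0-commutativeMonoid)
open import Data.Product using (∃; ∃-syntax; _×_; _,_)
open import Data.Vec using (Vec; lookup; last)
open import Function.Bundles using (_⇔_)
open import Level using (Level; 0ℓ)
open import Relation.Binary.PropositionalEquality using (_≡_; _≢_)
open import Relation.Nullary using (¬_)
open import Relation.Unary using (Pred; _∈_; _∉_; _⊆_)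

open import Algebra.Properties.CommutativeMonoid.Sum +-0-commutativeMonoid public
  using (sum-syntax)

private
  variable
    ℓ : Level

θ : ℕ → ℕ → ℕ → ℕ
θ a b x = a * x + b

record IsθSemigroup (a b : ℕ) (G : Pred ℕ ℓ) : Set ℓ where
  field
    0∈       : 0 ∈ G
    +-closed : ∀ {x y} → x ∈ G → y ∈ G → x + y ∈ G
    θ-closed : ∀ {y} → y ∈ G → y ≢ 0 → θ a b y ∈ G

-- The smallest θ-semigroup containing c, as an inductive predicate; that it
-- is one, and the smallest, is shown by ⟨⟩-isθSemigroup and ⟨⟩-least.
data ⟨_,_⟩ (a b c : ℕ) : Pred ℕ 0ℓ where
  gen  : ⟨ a , b ⟩ c c
  zero : ⟨ a , b ⟩ c 0
  add  : ∀ {x y} → ⟨ a , b ⟩ c x → ⟨ a , b ⟩ c y → ⟨ a , b ⟩ c (x + y)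
  step : ∀ {y} → ⟨ a , b ⟩ c y → y ≢ 0 → ⟨ a , b ⟩ c (θ a b y)

⟨⟩-isθSemigroup : ∀ a b c → IsθSemigroup a b (⟨ a , b ⟩ c)
⟨⟩-isθSemigroup a b c = record { 0∈ = zero ; +-closed = add ; θ-closed = step }

⟨⟩-least : ∀ a b c {H : Pred ℕ ℓ} → IsθSemigroup a b H → c ∈ H → ⟨ a , b ⟩ c ⊆ H
⟨⟩-least a b c {H} isθ c∈H = go
  where
  open IsθSemigroup isθ
  go : ⟨ a , b ⟩ c ⊆ H
  go gen          = c∈H
  go zero         = 0∈
  go (add p q)    = +-closed (go p) (go q)
  go (step p y≢0) = θ-closed (go p) y≢0

s : ℕ → ℕ → ℕ
s a k = ∑[ i < k ] (a ^ toℕ i)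

t : ℕ → ℕ → ℕ → ℕ → ℕ
t a b c k = a ^ k * c + b * s a k

-- A pair (n , j) is a family indexed by 1 , … , k with k = suc n; the entry
-- with index i + 1 is  lookup j i  for i : Fin k.
Family : Set
Family = ∃[ n ] Vec ℕ (suc n)

record Reduced (a : ℕ) (J : Family) : Set where
  constructor reduced
  private
    j = Data.Product.proj₂ J
  field
    bounded : ∀ i → lookup j i ≤ a
    last≢0  : last j ≢ 0
    zeros   : ∀ m → lookup j m ≡ a → ∀ i → i <ᶠ m → lookup j i ≡ 0

-- ∑ jᵢ f(i) over 1 ≤ i ≤ k
weightedSum : Family → (ℕ → ℕ) → ℕ
weightedSum (n , j) f = ∑[ i < suc n ] (lookup j i * f (suc (toℕ i)))

Represents : ℕ → ℕ → Family → Set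
Represents a l J = Reduced a J × l ≡ weightedSum J (s a)

-- J l is the family attached to l; the value J 0 is not used.
x[_,_,_] : ℕ → ℕ → ℕ → (J : ℕ → Family) → ℕ → ℕ
x[ a , b , c ] J zero        = 0
x[ a , b , c ] J l@(suc _) = weightedSum (J l) (t a b c)

_≡_[mod_] : ℕ → ℕ → ℕ → Set
m ≡ n [mod c ] = + c ℤ.∣ (+ m ℤ.- + n)

IsMin : Pred ℕ ℓ → ℕ → Set ℓ
IsMin P m = m ∈ P × (∀ {y} → y ∈ P → m ≤ y)

-- Membership of an integer in a subset of ℕ ⊆ ℤ
_∈ᶻ_ : ℤ → Pred ℕ ℓ → Set ℓ
z ∈ᶻ G = ∃[ n ] z ≡ + n × n ∈ G

IsFrobenius : Pred ℕ ℓ → ℤ → Set ℓ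
IsFrobenius G f = ¬ (f ∈ᶻ G) × (∀ z → ¬ (z ∈ᶻ G) → z ℤ.≤ f)

-- ℕ \ G is finite with exactly g elements.
IsGenus : Pred ℕ ℓ → ℕ → Set ℓ
IsGenus G g =
  ∃[ gaps ] Unique gaps × (∀ x → x ∈ˡ gaps ⇔ x ∉ G) × length gaps ≡ g

Ap : Pred ℕ ℓ → ℕ → Pred ℕ ℓ
Ap G n e = e ∈ G × ¬ ((+ e ℤ.- + n) ∈ᶻ G)

{-# OPTIONS --safe #-}
module Submission where

-- Writing t_i = a^i c + b s_i, the semigroup G generated by c under x |-> a x + b
-- is the set of all sums of t_0 = c, t_1, t_2, ... .  Collecting terms, its
-- elements are the numbers c E + b L, where (E , L) = (sum n_i a^i , sum n_i s_i)
-- for some finite sequence of multiplicities n_0, n_1, ... .  As b is prime to c,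
-- the class of c E + b L modulo c determines L modulo c.  So for l < c the least
-- element of G congruent to b l can be found by minimising E and L separately,
-- once it is known that the least E compatible with a given L is monotone in L.
--
-- The a-reduced families provide this minimum: if the digits j represent l and
-- have e = sum j_i a^i, then l <= L implies e <= E for every pair (E , L) as
-- above (pval-minimal).  The proof is a comparison of digit sequences.
-- Since s_(i+1) = s_i + a^i, prefixing a digit d turns (E , L) into
-- (d + a E , L + E), and induction along this recursion shows that E < e forces
-- L < l.  The same comparison gives uniqueness of reduced families: two of them
-- representing l have equal e, and then their lowest digits agree (head-≮),
-- whence all digits do.  Existence follows by adding 1 repeatedly, the only
-- carry being a s_i + 1 = s_(i+1).
--
-- Hence x_l = c e_l + b l is the least element of G congruent to b l, and x_l
-- is increasing in l because both e_l and l are.  The Apery set and the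
-- Frobenius number follow.  The gaps congruent to b l are the numbers
-- (x_l mod c) + i c with i < floor (x_l / c), so c times the genus is the sum of
-- the x_l minus the sum of the residues b l mod c over 0 < l < c.  The residues
-- of b l and b (c - l) add up to c, so twice the last sum is c (c - 1).

open import Defs
import Algebra.Properties.CommutativeMonoid.Sum as CommutativeMonoidSum
open import Algebra.Properties.CommutativeSemigroup using (x∙yz≈y∙xz; x∙yz≈xz∙y)
open import Algebra.Properties.Semiring.Sum using (*-distribˡ-sum; *-distribʳ-sum)
open import Data.Fin using (Fin; zero; suc; toℕ; fromℕ<; opposite)
import Data.Fin as Fin
import Data.Fin.Permutation as Permutation
open import Data.Fin.Properties using (toℕ<n; toℕ-injective; toℕ-fromℕ<; opposite-prop)
open import Data.Integer using (+_; -[1+_])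
import Data.Integer as ℤ
import Data.Integer.Properties as ℤ
import Data.Integer.Tactic.RingSolver as ℤ-Solver
open import Data.List using (List; concat; tabulate; applyUpTo; length)
open import Data.List.Membership.Propositional using () renaming (_∈_ to _∈ˡ_)
open import Data.List.Membership.Propositional.Properties using (∈-applyUpTo⁺; ∈-applyUpTo⁻; ∈-concat⁺′; ∈-concat⁻′; ∈-tabulate⁺; ∈-tabulate⁻)
open import Data.List.Properties using (length-++; length-applyUpTo)
import Data.List.Relation.Unary.All.Properties as ListAll
import Data.List.Relation.Unary.AllPairs.Properties as AllPairs
open import Data.List.Relation.Unary.Unique.Propositional using (Unique)
import Data.List.Relation.Unary.Unique.Propositional.Properties as Unique
open import Data.Nat using (ℕ; zero; suc; _+_; _*_; _∸_; _^_; _/_; _%_; _≤_; _<_; _≟_; ∣_-_∣; NonZero; >-nonZero⁻¹; z≤n; s≤s; z<s; s<s)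
open import Data.Nat.Coprimality using (Coprime; coprime-divisor; coprime-Bézout; gcd≡1⇒coprime) renaming (sym to coprime-sym)
open import Data.Nat.DivMod
open import Data.Nat.Divisibility using (_∣_; divides; ∣n⇒∣m*n; m%n≡0⇒n∣m)
open import Data.Nat.GCD using (gcd; module Bézout)
open import Data.Nat.Properties
open import Data.Nat.Tactic.RingSolver using (solve-∀)
open import Data.Product using (∃; ∃!; ∃-syntax; _×_; _,_; proj₁; proj₂)
import Data.Rational as ℚ
import Data.Rational.Properties as ℚ
import Data.Rational.Unnormalised as ℚᵘ
import Data.Rational.Unnormalised.Properties as ℚᵘ
open import Data.Sum using (_⊎_; inj₁; inj₂)
open import Data.Unit using (⊤; tt)
open import Data.Vec using (Vec; []; _∷_; lookup; last)
open import Data.Vec.Relation.Unary.All using (All; []; _∷_)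
open import Data.Vec.Relation.Unary.All.Properties using (lookup⁺; lookup⁻)
open import Function using (_∘_; mk⇔)
open import Level using (0ℓ)
open import Relation.Binary.Definitions using (tri<; tri≈; tri>)
open import Relation.Binary.PropositionalEquality
open import Relation.Nullary using (¬_; yes; no; contradiction)
open import Relation.Unary using (Pred; _∈_; _∉_; _≐_)

private
  module Sum = CommutativeMonoidSum +-0-commutativeMonoid

-- The numbers s_i and weighted digit sums

s-suc : ∀ a k → s a (suc k) ≡ 1 + a * s a k
s-suc a k = cong suc (sym (*-distribˡ-sum +-*-semiring {k} a (λ i → a ^ toℕ i)))

s-suc′ : ∀ a k → s a (suc k) ≡ s a k + a ^ k
s-suc′ a zero    = refl
s-suc′ a (suc k) = begin
  s a (suc (suc k))          ≡⟨ s-suc a (suc k) ⟩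
  1 + a * s a (suc k)        ≡⟨ cong (λ z → 1 + a * z) (s-suc′ a k) ⟩
  1 + a * (s a k + a ^ k)    ≡⟨ cong suc (*-distribˡ-+ a (s a k) (a ^ k)) ⟩
  1 + a * s a k + a ^ suc k  ≡⟨ cong (_+ a ^ suc k) (s-suc a k) ⟨
  s a (suc k) + a ^ suc k    ∎
  where open ≡-Reasoning

-- For digits d_0, ..., d_(n-1), pval is the sum of the d_i a^i and sval the sum
-- of the d_i s_i, both in Horner form; the closed forms are digitSum-^ and
-- digitSum-s.  Positions start at 0 here, so a family indexed from 1 corresponds
-- to the vector 0 ∷ j.
pval : ∀ {n} → ℕ → Vec ℕ n → ℕ
pval a []      = 0
pval a (d ∷ v) = d + a * pval a v

sval : ∀ {n} → ℕ → Vec ℕ n → ℕ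
sval a []      = 0
sval a (d ∷ v) = sval a v + pval a v

-- The sum of the d_i f(i), starting at position 0.  The weightedSum of a family
-- (n , j) is definitionally the digitSum of 0 ∷ j.
digitSum : ∀ {n} → Vec ℕ n → (ℕ → ℕ) → ℕ
digitSum {n} v f = ∑[ i < n ] (lookup v i * f (toℕ i))

digitSum-cong : ∀ {n} (v : Vec ℕ n) {f g : ℕ → ℕ} → (∀ i → f i ≡ g i) →
                digitSum v f ≡ digitSum v g
digitSum-cong v eq = Sum.sum-cong-≗ (λ i → cong (lookup v i *_) (eq (toℕ i)))

digitSum-+ : ∀ {n} (v : Vec ℕ n) (f g : ℕ → ℕ) →
             digitSum v (λ i → f i + g i) ≡ digitSum v f + digitSum v g
digitSum-+ {n} v f g = trans
  (Sum.sum-cong-≗ (λ i → *-distribˡ-+ (lookup v i) (f (toℕ i)) (g (toℕ i))))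
  (Sum.∑-distrib-+ {n} (λ i → lookup v i * f (toℕ i)) (λ i → lookup v i * g (toℕ i)))

digitSum-* : ∀ {n} (v : Vec ℕ n) k (f : ℕ → ℕ) →
             digitSum v (λ i → k * f i) ≡ k * digitSum v f
digitSum-* {n} v k f = trans
  (Sum.sum-cong-≗ (λ i → x∙yz≈y∙xz *-commutativeSemigroup (lookup v i) k (f (toℕ i))))
  (sym (*-distribˡ-sum +-*-semiring {n} k (λ i → lookup v i * f (toℕ i))))

digitSum-^ : ∀ a {n} (v : Vec ℕ n) → digitSum v (a ^_) ≡ pval a v
digitSum-^ a []      = refl
digitSum-^ a (d ∷ v) =
  cong₂ _+_ (*-identityʳ d) (trans (digitSum-* v a (a ^_)) (cong (a *_) (digitSum-^ a v)))

digitSum-s : ∀ a {n} (v : Vec ℕ n) → digitSum v (s a) ≡ sval a v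
digitSum-s a []      = refl
digitSum-s a (d ∷ v) = begin
  d * 0 + digitSum v (λ i → s a (suc i))  ≡⟨ cong₂ _+_ (*-zeroʳ d) (digitSum-cong v (s-suc′ a)) ⟩
  digitSum v (λ i → s a i + a ^ i)        ≡⟨ digitSum-+ v (s a) (a ^_) ⟩
  digitSum v (s a) + digitSum v (a ^_)    ≡⟨ cong₂ _+_ (digitSum-s a v) (digitSum-^ a v) ⟩
  sval a v + pval a v                     ∎
  where open ≡-Reasoning

digitSum-t : ∀ a b c {n} (v : Vec ℕ n) → digitSum v (t a b c) ≡ c * pval a v + b * sval a v
digitSum-t a b c v = begin
  digitSum v (t a b c)
    ≡⟨ digitSum-cong v (λ i → cong (_+ b * s a i) (*-comm (a ^ i) c)) ⟩
  digitSum v (λ i → c * a ^ i + b * s a i)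
    ≡⟨ digitSum-+ v (λ i → c * a ^ i) (λ i → b * s a i) ⟩
  digitSum v (λ i → c * a ^ i) + digitSum v (λ i → b * s a i)
    ≡⟨ cong₂ _+_ (digitSum-* v c (a ^_)) (digitSum-* v b (s a)) ⟩
  c * digitSum v (a ^_) + b * digitSum v (s a)
    ≡⟨ cong₂ (λ p q → c * p + b * q) (digitSum-^ a v) (digitSum-s a v) ⟩
  c * pval a v + b * sval a v ∎
  where open ≡-Reasoning

-- Reduced digit sequences

-- Expansion a E L: some multiplicities n_0, n_1, ... satisfy
-- E = sum n_i a^i and L = sum n_i s_i.  They are listed from n_0 on and are
-- otherwise arbitrary.
data Expansion (a : ℕ) : ℕ → ℕ → Set where
  []  : Expansion a 0 0
  _∷_ : ∀ d {E L} → Expansion a E L → Expansion a (d + a * E) (L + E)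

expand : ∀ a {n} (v : Vec ℕ n) → Expansion a (pval a v) (sval a v)
expand a []      = []
expand a (d ∷ v) = d ∷ expand a v

-- Reduced digits, without the condition on the last one: after some zeros at the
-- low end comes a digit that is at most a, and all higher digits are below a.
data Red (a : ℕ) : ∀ {n} → Vec ℕ n → Set where
  []   : Red a []
  0∷_  : ∀ {n} {v : Vec ℕ n} → Red a v → Red a (0 ∷ v)
  _∷_  : ∀ {n d} {v : Vec ℕ n} → d ≤ a → All (_< a) v → Red a (d ∷ v)

head-≤ : ∀ {a n d} {v : Vec ℕ n} → Red a (d ∷ v) → d ≤ a
head-≤ (0∷ r) = z≤n
head-≤ (d≤a ∷ _) = d≤a

All<⇒Red : ∀ {a n} {v : Vec ℕ n} → All (_< a) v → Red a v
All<⇒Red []       = []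
All<⇒Red (d<a ∷ ds) = <⇒≤ d<a ∷ ds

tail-Red : ∀ {a n d} {v : Vec ℕ n} → Red a (d ∷ v) → Red a v
tail-Red (0∷ r)   = r
tail-Red (_ ∷ ds) = All<⇒Red ds

module _ {a : ℕ} .{{_ : NonZero a}} where

  quot-≤ : ∀ {d e E E′} → e < a → d + a * E ≤ e + a * E′ → E ≤ E′
  quot-≤ {d} {e} {E} {E′} e<a le = ≤-pred (*-cancelˡ-< a E (suc E′) (begin-strict
    a * E       ≤⟨ m≤n+m (a * E) d ⟩
    d + a * E   ≤⟨ le ⟩
    e + a * E′  <⟨ +-monoˡ-< (a * E′) e<a ⟩
    a + a * E′  ≡⟨ *-suc a E′ ⟨
    a * suc E′  ∎))
    where open ≤-Reasoning

  quot-< : ∀ {d E E′} → d + a * E < a * E′ → E < E′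
  quot-< {d} {E} {E′} lt = *-cancelˡ-< a E E′ (≤-<-trans (m≤n+m (a * E) d) lt)

  zero-expansion : ∀ {E L} → Expansion a E L → E ≡ 0 → L ≡ 0
  zero-expansion []          _  = refl
  zero-expansion (_∷_ d {E} p) eq =
    cong₂ _+_ (zero-expansion p E≡0) E≡0
    where
    E≡0 : E ≡ 0
    E≡0 = n≤0⇒n≡0 (quot-≤ {d} {0} (>-nonZero⁻¹ a) (≤-reflexive (trans eq (sym (*-zeroʳ a)))))

  -- Digits below a have the largest possible sval among all expansions with at
  -- most the same pval.
  All<-mono : ∀ {n} {v : Vec ℕ n} → All (_< a) v →
              ∀ {E L} → Expansion a E L → E ≤ pval a v → L ≤ sval a v
  All<-mono []         p E≤ = ≤-reflexive (zero-expansion p (n≤0⇒n≡0 E≤))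
  All<-mono (_ ∷ _)    [] _ = z≤n
  All<-mono (e<a ∷ ds) (d ∷ p) E≤ =
    let E≤′ = quot-≤ {d} e<a E≤ in +-mono-≤ (All<-mono ds p E≤′) E≤′

  -- If the digit a occurs, a strict inequality between the first components is
  -- needed: E = a also arises from the multiplicities 0, 1, which have L = 1,
  -- while the single digit a in position 0 has sval 0.
  Red-mono : ∀ {n} {v : Vec ℕ n} → Red a v →
             ∀ {E L} → Expansion a E L → E < pval a v → L ≤ sval a v
  Red-mono _        []      _  = z≤n
  Red-mono (0∷ r)   (d ∷ p) lt =
    let E<  = quot-< {d} lt in +-mono-≤ (Red-mono r p E<) (<⇒≤ E<)
  Red-mono (_∷_ {d = e} {v = v} e≤a ds) (_∷_ d {E} p) lt =
    +-mono-≤ (All<-mono ds p E≤) E≤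
    where
    open ≤-Reasoning
    E≤ : E ≤ pval a v
    E≤ = ≤-pred (quot-< {d} (begin-strict
      d + a * E          <⟨ lt ⟩
      e + a * pval a v   ≤⟨ +-monoˡ-≤ (a * pval a v) e≤a ⟩
      a + a * pval a v   ≡⟨ *-suc a (pval a v) ⟨
      a * suc (pval a v) ∎))

  Red-mono-< : ∀ {n} {v : Vec ℕ n} → Red a v →
               ∀ {E L} → Expansion a E L → E < pval a (0 ∷ v) → L < sval a (0 ∷ v)
  Red-mono-< {v = v} r []      lt =
    <-≤-trans (quot-< {0} {0} (subst (_< a * pval a v) (sym (*-zeroʳ a)) lt))
              (m≤n+m (pval a v) (sval a v))
  Red-mono-< r (d ∷ p) lt =
    let E<  = quot-< {d} lt in +-mono-≤-< (Red-mono r p E<) E<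

  -- A reduced family minimises the first component among all expansions whose
  -- second component is at least as large.
  pval-minimal : ∀ {n} {v : Vec ℕ n} → Red a v →
                 ∀ {E L} → Expansion a E L → sval a (0 ∷ v) ≤ L → pval a (0 ∷ v) ≤ E
  pval-minimal r p l≤L = ≮⇒≥ λ E< → <⇒≱ (Red-mono-< r p E<) l≤L

  -- Existence and uniqueness of reduced families

  -- The highest digit is nonzero; vacuous for the empty vector, so that the
  -- condition passes to tails.
  LastNonZero : ∀ {n} → Vec ℕ n → Set
  LastNonZero []        = ⊤
  LastNonZero v@(_ ∷ _) = last v ≢ 0

  tail-LastNonZero : ∀ {n d} (v : Vec ℕ n) → LastNonZero (d ∷ v) → LastNonZero v
  tail-LastNonZero []      _ = tt
  tail-LastNonZero (_ ∷ _) z = z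

  pval-≡0 : ∀ {n} (v : Vec ℕ (suc n)) → pval a v ≡ 0 → last v ≡ 0
  pval-≡0 (d ∷ [])        eq = m+n≡0⇒m≡0 d eq
  pval-≡0 (d ∷ v@(_ ∷ _)) eq =
    pval-≡0 v (m*n≡0⇒m≡0 (pval a v) a (trans (*-comm (pval a v) a) (m+n≡0⇒n≡0 d eq)))

  -- If d < e then pval v > pval w, so sval v >= sval w by Red-mono, and the sums
  -- sval + pval of the two tails cannot agree.
  head-≮ : ∀ {m n d e} {v : Vec ℕ m} {w : Vec ℕ n} → Red a v →
           pval a (d ∷ v) ≡ pval a (e ∷ w) → sval a (d ∷ v) ≡ sval a (e ∷ w) → ¬ d < e
  head-≮ {d = d} {e} {v} {w} r pv≡ sv≡ d<e =
    <⇒≢ (+-mono-≤-< (Red-mono r (expand a w) pw<pv) pw<pv) (sym sv≡)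
    where
    pw<pv : pval a w < pval a v
    pw<pv = *-cancelˡ-< a _ _ (+-cancelˡ-< e _ _
              (subst (_< e + a * pval a v) pv≡ (+-monoˡ-< (a * pval a v) d<e)))

  Red-unique : ∀ {m n} {v : Vec ℕ m} {w : Vec ℕ n} →
               Red a v → Red a w → LastNonZero v → LastNonZero w →
               pval a v ≡ pval a w → sval a v ≡ sval a w →
               _≡_ {A = ∃ (Vec ℕ)} (m , v) (n , w)
  Red-unique {v = []}    {[]}    _ _ _ _ _ _ = refl
  Red-unique {v = []}    {w@(_ ∷ _)} _ _ _ z pv≡ _ = contradiction (pval-≡0 w (sym pv≡)) z
  Red-unique {v = v@(_ ∷ _)} {[]}    _ _ z _ pv≡ _ = contradiction (pval-≡0 v pv≡) z
  Red-unique {v = d ∷ v} {e ∷ w} r r′ z z′ pv≡ sv≡ with <-cmp d e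
  ... | tri< d<e _ _ = contradiction d<e (head-≮ {v = v} {w} (tail-Red r) pv≡ sv≡)
  ... | tri> _ _ e<d = contradiction e<d (head-≮ {v = w} {v} (tail-Red r′) (sym pv≡) (sym sv≡))
  ... | tri≈ _ refl _ =
    cong (λ (k , u) → suc k , d ∷ u)
         (Red-unique (tail-Red r) (tail-Red r′) (tail-LastNonZero v z) (tail-LastNonZero w z′)
                     tail≡ (+-cancelʳ-≡ _ _ _ (trans sv≡ (cong (_+_ (sval a w)) (sym tail≡)))))
    where
    tail≡ : pval a v ≡ pval a w
    tail≡ = *-cancelˡ-≡ _ _ a (+-cancelˡ-≡ d _ _ pv≡)

  -- There are nonempty reduced digits w with P (pval a w) (sval a w).
  ReducedWith : (ℕ → ℕ → Set) → Set
  ReducedWith P = ∃[ m ] ∃[ w ] Red a {suc m} w × last w ≢ 0 × P (pval a w) (sval a w)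

  -- Adding 1 to the zeroth digit, which is below a.  The empty vector becomes the
  -- single digit 1, which is reduced even for a = 1, although it equals a then.
  increment : ∀ {n} {v : Vec ℕ n} → All (_< a) v → LastNonZero v →
              ReducedWith (λ p q → p ≡ suc (pval a v) × q ≡ sval a v)
  increment []                  _ = 0 , 1 ∷ [] , >-nonZero⁻¹ a ∷ [] , (λ ()) , cong suc (*-zeroʳ a) , refl
  increment {v = d ∷ []}        (d<a ∷ ds) _ = _ , suc d ∷ [] , d<a ∷ ds , (λ ()) , refl , refl
  increment {v = d ∷ v@(_ ∷ _)} (d<a ∷ ds) z = _ , suc d ∷ v , d<a ∷ ds , z , refl , refl

  -- Either all digits are below a, or some digit is a.  In the second case all
  -- digits below that one vanish; replacing it by 0 and adding 1 to the next is
  -- the carry a s_i + 1 = s_(i+1), which leaves pval unchanged.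
  carry : ∀ {n} {v : Vec ℕ n} → Red a v → LastNonZero v →
          All (_< a) v ⊎ ReducedWith (λ p q → p ≡ pval a v × q ≡ suc (sval a v))
  carry [] _ = inj₁ []
  carry {v = _ ∷ v} (0∷ r) z with carry r (tail-LastNonZero v z)
  ... | inj₁ ds = inj₁ (>-nonZero⁻¹ a ∷ ds)
  ... | inj₂ (_ , w@(_ ∷ _) , r′ , z′ , p≡ , q≡) =
    inj₂ (_ , 0 ∷ w , 0∷ r′ , z′ , cong (a *_) p≡ , cong₂ _+_ q≡ p≡)
  carry {v = d ∷ v} (d≤a ∷ ds) z with m≤n⇒m<n∨m≡n d≤a
  ... | inj₁ d<a  = inj₁ (d<a ∷ ds)
  ... | inj₂ refl with increment ds (tail-LastNonZero v z)
  ...   | _ , w@(_ ∷ _) , r′ , z′ , p≡ , q≡ =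
    inj₂ (_ , 0 ∷ w , 0∷ r′ , z′ , trans (cong (a *_) p≡) (*-suc a (pval a v))
             , trans (cong₂ _+_ q≡ p≡) (+-suc (sval a v) (pval a v)))

  -- The number represented by the family v is sval a v + pval a v, the sval of
  -- 0 ∷ v.
  successor : ∀ {n} {v : Vec ℕ n} → Red a v → LastNonZero v →
              ReducedWith (λ p q → q + p ≡ suc (sval a v + pval a v))
  successor {v = v} r z with carry r z
  ... | inj₂ (_ , w , r′ , z′ , p≡ , q≡) = _ , w , r′ , z′ , cong₂ _+_ q≡ p≡
  ... | inj₁ ds with increment ds z
  ...   | _ , w , r′ , z′ , p≡ , q≡ =
    _ , w , r′ , z′ , trans (cong₂ _+_ q≡ p≡) (+-suc (sval a v) (pval a v))

  represent : ∀ l → ReducedWith (λ p q → q + p ≡ suc l)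
  represent zero    = successor {v = []} [] tt
  represent (suc l) with represent l
  ... | _ , w@(_ ∷ _) , r , z , eq with successor r z
  ...   | _ , w′ , r′ , z′ , eq′ = _ , w′ , r′ , z′ , trans eq′ (cong suc eq)

≤∧zeros⇒Red : ∀ {a n} (v : Vec ℕ n) → (∀ i → lookup v i ≤ a) →
              (∀ m → lookup v m ≡ a → ∀ i → i Fin.< m → lookup v i ≡ 0) → Red a v
≤∧zeros⇒Red []          _  _  = []
≤∧zeros⇒Red (zero ∷ v)  v≤ v0 =
  0∷ ≤∧zeros⇒Red v (v≤ ∘ suc) (λ m eq i i<m → v0 (suc m) eq (suc i) (s<s i<m))
≤∧zeros⇒Red (suc d ∷ v) v≤ v0 =
  v≤ zero ∷ lookup⁻ (λ m → ≤∧≢⇒< (v≤ (suc m)) (λ eq → contradiction (v0 (suc m) eq zero z<s) λ ()))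

Red⇒≤ : ∀ {a n} {v : Vec ℕ n} → Red a v → ∀ i → lookup v i ≤ a
Red⇒≤ {v = _ ∷ _} r zero    = head-≤ r
Red⇒≤ {v = _ ∷ _} r (suc i) = Red⇒≤ (tail-Red r) i

Red⇒zeros : ∀ {a n} {v : Vec ℕ n} → Red a v →
            ∀ m → lookup v m ≡ a → ∀ i → i Fin.< m → lookup v i ≡ 0
Red⇒zeros (0∷ r)   (suc m) eq zero    _         = refl
Red⇒zeros (0∷ r)   (suc m) eq (suc i) (s<s i<m) = Red⇒zeros r m eq i i<m
Red⇒zeros (_ ∷ ds) (suc m) eq _       _         = contradiction eq (<⇒≢ (lookup⁺ ds m))

Reduced⇒Red : ∀ {a} {J : Family} → Reduced a J → Red a (proj₂ J)
Reduced⇒Red {J = _ , j} r = ≤∧zeros⇒Red j (Reduced.bounded r) (Reduced.zeros r)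

∃!-Represents : ∀ a .{{_ : NonZero a}} l → 1 ≤ l → ∃! _≡_ (Represents a l)
∃!-Represents a (suc l) _ with represent {a} l
... | n , v@(_ ∷ _) , r , z , eq = (n , v) ,
  (reduced (Red⇒≤ r) z (Red⇒zeros r) , sym (trans (digitSum-s a (0 ∷ v)) eq)) , unique
  where
  unique : ∀ {K} → Represents a (suc l) K → (n , v) ≡ K
  unique {m , w@(_ ∷ _)} (r′ , eq′) = drop-suc (Red-unique r rw z (Reduced.last≢0 r′) p≡ v≡)
    where
    rw = Reduced⇒Red r′
    -- Red-unique compares vectors of any length, families are nonempty vectors.
    drop-suc : ∀ {m n} {v : Vec ℕ (suc m)} {w : Vec ℕ (suc n)} →
               _≡_ {A = ∃ (Vec ℕ)} (suc m , v) (suc n , w) → _≡_ {A = Family} (m , v) (n , w)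
    drop-suc refl = refl
    s≡ : sval a (0 ∷ v) ≡ sval a (0 ∷ w)
    s≡ = trans eq (trans eq′ (digitSum-s a (0 ∷ w)))
    p≡ : pval a v ≡ pval a w
    p≡ = *-cancelˡ-≡ _ _ a (≤-antisym (pval-minimal r (expand a (0 ∷ w)) (≤-reflexive s≡))
                                      (pval-minimal rw (expand a (0 ∷ v)) (≤-reflexive (sym s≡))))
    v≡ : sval a v ≡ sval a w
    v≡ = +-cancelʳ-≡ _ _ _ (trans s≡ (cong (_+_ (sval a w)) (sym p≡)))

-- Elements of the semigroup as expansions

module _ {a : ℕ} where

  -- Addition of multiplicities.
  _⊕_ : ∀ {E L E′ L′} → Expansion a E L → Expansion a E′ L′ → Expansion a (E + E′) (L + L′)
  []       ⊕ q = q
  p@(_ ∷ _) ⊕ [] = subst₂ (Expansion a) (sym (+-identityʳ _)) (sym (+-identityʳ _)) p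
  _⊕_ (_∷_ d {E} {L} p) (_∷_ d′ {E′} {L′} p′) =
    subst₂ (Expansion a) (lemE a d d′ E E′) (lemL L E L′ E′) ((d + d′) ∷ (p ⊕ p′))
    where
    lemE : ∀ a d d′ E E′ → d + d′ + a * (E + E′) ≡ d + a * E + (d′ + a * E′)
    lemE = solve-∀
    lemL : ∀ L E L′ E′ → L + L′ + (E + E′) ≡ L + E + (L′ + E′)
    lemL = solve-∀

  -- The effect of x |-> a x + b on c E + b L.  One summand t_i is replaced by
  -- t_(i+1) = a t_i + b and all the others are multiplied by a.
  θ-Expansion : .{{_ : NonZero a}} → ∀ {E L} → Expansion a E L → E ≢ 0 → Expansion a (a * E) (1 + a * L)
  θ-Expansion [] E≢0 = contradiction refl E≢0
  θ-Expansion (_∷_ d {E} {L} p) dE≢0 with E ≟ 0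
  ... | no E≢0 = subst₂ (Expansion a) (sym (*-distribˡ-+ a d (a * E)))
                   (cong suc (sym (*-distribˡ-+ a L E))) ((a * d) ∷ θ-Expansion p E≢0)
  ... | yes refl with refl ← zero-expansion p refl with d
  ...   | zero = contradiction (*-zeroʳ a) dE≢0
  ...   | suc d =
    -- Here only t_0 occurs, d + 1 times; one copy becomes t_1.
    subst₂ (Expansion a) (lemE a d) (lemL a) ((a * d) ∷ (1 ∷ []))
    where
    lemE : ∀ a d → a * d + a * (1 + a * 0) ≡ a * (suc d + a * 0)
    lemE = solve-∀
    lemL : ∀ a → 0 + 0 + (1 + a * 0) ≡ 1 + a * 0
    lemL = solve-∀

∈⇒Expansion : ∀ {a b c} .{{_ : NonZero a}} {y} → y ∈ ⟨ a , b ⟩ c → ∃[ E ] ∃[ L ] Expansion a E L × y ≡ c * E + b * L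
∈⇒Expansion {a} {b} {c} gen = _ , _ , 1 ∷ [] , lem a b c
  where
  lem : ∀ a b c → c ≡ c * (1 + a * 0) + b * (0 + 0)
  lem = solve-∀
∈⇒Expansion {a} {b} {c} zero = 0 , 0 , [] , lem b c
  where
  lem : ∀ b c → 0 ≡ c * 0 + b * 0
  lem = solve-∀
∈⇒Expansion {a} {b} {c} (add y∈ z∈) with ∈⇒Expansion y∈ | ∈⇒Expansion z∈
... | E , L , p , refl | E′ , L′ , p′ , refl = _ , _ , p ⊕ p′ , lem b c E L E′ L′
  where
  lem : ∀ b c E L E′ L′ → c * E + b * L + (c * E′ + b * L′) ≡ c * (E + E′) + b * (L + L′)
  lem = solve-∀
∈⇒Expansion {a} {b} {c} (step y∈ y≢0) with ∈⇒Expansion y∈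
... | E , L , p , refl = _ , _ , θ-Expansion p E≢0 , lem a b c E L
  where
  E≢0 : E ≢ 0
  E≢0 refl with refl ← zero-expansion p refl = y≢0 (cong₂ _+_ (*-zeroʳ c) (*-zeroʳ b))
  lem : ∀ a b c E L → a * (c * E + b * L) + b ≡ c * (a * E) + b * (1 + a * L)
  lem = solve-∀

module _ {a b c : ℕ} where
  private
    G = ⟨ a , b ⟩ c

  *-closed : ∀ k {y} → y ∈ G → k * y ∈ G
  *-closed zero    y∈ = zero
  *-closed (suc k) y∈ = add y∈ (*-closed k y∈)

  sum-closed : ∀ n (f : Fin n → ℕ) → (∀ i → f i ∈ G) → ∑[ i < n ] f i ∈ G
  sum-closed zero    f f∈ = zero
  sum-closed (suc n) f f∈ = add (f∈ zero) (sum-closed n (f ∘ suc) (f∈ ∘ suc))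

  t∈G : .{{_ : NonZero a}} .{{_ : NonZero c}} → ∀ k → t a b c k ∈ G
  t∈G zero    = subst (_∈ G) (lem b c) gen
    where
    lem : ∀ b c → c ≡ 1 * c + b * 0
    lem = solve-∀
  t∈G (suc k) = subst (_∈ G) eq (step (t∈G k) t≢0)
    where
    t≢0 : t a b c k ≢ 0
    t≢0 eq = <⇒≢ (m^n>0 a k) (sym (m*n≡0⇒m≡0 (a ^ k) c (m+n≡0⇒m≡0 (a ^ k * c) eq)))
    lem : ∀ a b c p q → a * (p * c + b * q) + b ≡ a * p * c + b * (1 + a * q)
    lem = solve-∀
    eq : θ a b (t a b c k) ≡ t a b c (suc k)
    eq = trans (lem a b c (a ^ k) (s a k)) (cong (λ z → a ^ suc k * c + b * z) (sym (s-suc a k)))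

-- Congruences modulo c

module _ {c : ℕ} .{{_ : NonZero c}} where

  %-≡⇒+ : ∀ {m n} → m ≤ n → m % c ≡ n % c → ∃[ k ] n ≡ m + k * c
  %-≡⇒+ {m} {n} m≤n eq = n / c ∸ m / c , (begin
    n                                                    ≡⟨ m≡m%n+[m/n]*n n c ⟩
    n % c + (n / c) * c                                  ≡⟨ cong₂ (λ r q → r + q * c) (sym eq) (sym (m+[n∸m]≡n (/-monoˡ-≤ c m≤n))) ⟩
    m % c + (m / c + (n / c ∸ m / c)) * c                ≡⟨ cong (_+_ (m % c)) (*-distribʳ-+ c (m / c) _) ⟩
    m % c + ((m / c) * c + (n / c ∸ m / c) * c)          ≡⟨ +-assoc (m % c) _ _ ⟨
    m % c + (m / c) * c + (n / c ∸ m / c) * c            ≡⟨ cong (_+ (n / c ∸ m / c) * c) (m≡m%n+[m/n]*n m c) ⟨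
    m + (n / c ∸ m / c) * c ∎)
    where open ≡-Reasoning

  %-≡∧<⇒+≤ : ∀ {m n} → m < n → m % c ≡ n % c → m + c ≤ n
  %-≡∧<⇒+≤ {m} m<n eq with %-≡⇒+ (<⇒≤ m<n) eq
  ... | zero  , refl = contradiction (sym (+-identityʳ m)) (<⇒≢ m<n)
  ... | suc k , refl = +-monoʳ-≤ m (m≤m+n c (k * c))

  ∣-∣⇒%≡ : ∀ m n → c ∣ ∣ m - n ∣ → m % c ≡ n % c
  ∣-∣⇒%≡ m n d with ≤-total m n
  ... | inj₁ m≤n = sym (trans (cong (_% c) (sym (m+[n∸m]≡n m≤n)))
                     (%-remove-+ʳ m (subst (c ∣_) (m≤n⇒∣m-n∣≡n∸m m≤n) d)))
  ... | inj₂ n≤m = trans (cong (_% c) (sym (m+[n∸m]≡n n≤m)))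
                     (%-remove-+ʳ n (subst (c ∣_) (m≤n⇒∣n-m∣≡n∸m n≤m) d))

  %≡⇒∣-∣ : ∀ m n → m % c ≡ n % c → c ∣ ∣ m - n ∣
  %≡⇒∣-∣ m n eq with ≤-total m n
  ... | inj₁ m≤n with k , refl ← %-≡⇒+ m≤n eq = divides k (∣m-m+n∣≡n m (k * c))
  ... | inj₂ n≤m with k , refl ← %-≡⇒+ n≤m (sym eq) = divides k (∣m+n-m∣≡n n (k * c))
    where
    ∣m+n-m∣≡n : ∀ m n → ∣ m + n - m ∣ ≡ n
    ∣m+n-m∣≡n m n = trans (∣-∣-comm (m + n) m) (∣m-m+n∣≡n m n)

  ∣+m-+n∣≡∣m-n∣ : ∀ m n → ℤ.∣ + m ℤ.- + n ∣ ≡ ∣ m - n ∣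
  ∣+m-+n∣≡∣m-n∣ m n with ≤-total m n
  ... | inj₁ m≤n = trans (cong ℤ.∣_∣ (ℤ.m-n≡m⊖n m n)) (trans (ℤ.∣⊖∣-≤ m≤n) (sym (m≤n⇒∣m-n∣≡n∸m m≤n)))
  ... | inj₂ n≤m = trans (cong ℤ.∣_∣ (trans (ℤ.m-n≡m⊖n m n) (ℤ.⊖-≥ n≤m))) (sym (m≤n⇒∣n-m∣≡n∸m n≤m))

  mod⇒% : ∀ m n → m ≡ n [mod c ] → m % c ≡ n % c
  mod⇒% m n d = ∣-∣⇒%≡ m n (subst (c ∣_) (∣+m-+n∣≡∣m-n∣ m n) d)

  %⇒mod : ∀ m n → m % c ≡ n % c → m ≡ n [mod c ]
  %⇒mod m n eq = subst (c ∣_) (sym (∣+m-+n∣≡∣m-n∣ m n)) (%≡⇒∣-∣ m n eq)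

  module _ {b : ℕ} (b⊥c : Coprime b c) where

    *-cancelˡ-% : ∀ l l′ → (b * l) % c ≡ (b * l′) % c → l % c ≡ l′ % c
    *-cancelˡ-% l l′ eq = ∣-∣⇒%≡ l l′ (coprime-divisor (coprime-sym b⊥c)
      (subst (c ∣_) (sym (*-distribˡ-∣-∣ b l l′)) (%≡⇒∣-∣ (b * l) (b * l′) eq)))

    *-reduce-% : ∀ l → (b * (l % c)) % c ≡ (b * l) % c
    *-reduce-% l = ∣-∣⇒%≡ (b * (l % c)) (b * l) (subst (c ∣_) (*-distribˡ-∣-∣ b (l % c) l)
      (∣n⇒∣m*n b (%≡⇒∣-∣ (l % c) l (m%n%n≡m%n l c))))

    *-surjective-% : ∀ n → ∃[ l ] l < c × (b * l) % c ≡ n % c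
    *-surjective-% n with sol
      where
      sol : ∃[ l ] (b * l) % c ≡ n % c
      sol with coprime-Bézout b⊥c
      ... | Bézout.+- x y eq = x * n , (begin
        (b * (x * n)) % c       ≡⟨ cong (_% c) (lem₁ b x n) ⟩
        (x * b * n) % c         ≡⟨ cong (λ z → (z * n) % c) eq ⟨
        ((1 + y * c) * n) % c   ≡⟨ cong (_% c) (lem₂ y c n) ⟩
        (n + y * n * c) % c     ≡⟨ [m+kn]%n≡m%n n (y * n) c ⟩
        n % c ∎)
        where
        open ≡-Reasoning
        lem₁ : ∀ b x n → b * (x * n) ≡ x * b * n
        lem₁ = solve-∀
        lem₂ : ∀ y c n → (1 + y * c) * n ≡ n + y * n * c
        lem₂ = solve-∀
      -- Here b x = -1 modulo c, so n is multiplied by c - 1 to correct the sign.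
      ... | Bézout.-+ x y eq = x * (n * (c ∸ 1)) , (begin
        (b * (x * (n * c′))) % c          ≡⟨ [m+kn]%n≡m%n _ n c ⟨
        (b * (x * (n * c′)) + n * c) % c  ≡⟨ cong (λ z → (b * (x * (n * c′)) + n * z) % c) (sym c≡) ⟩
        (b * (x * (n * c′)) + n * suc c′) % c  ≡⟨ cong (_% c) (lem₁ b x n c′) ⟩
        (n + (1 + x * b) * n * c′) % c    ≡⟨ cong (λ z → (n + z * n * c′) % c) eq ⟩
        (n + y * c * n * c′) % c          ≡⟨ cong (_% c) (lem₂ y c n c′) ⟩
        (n + y * n * c′ * c) % c          ≡⟨ [m+kn]%n≡m%n n (y * n * c′) c ⟩
        n % c ∎)
        where
        open ≡-Reasoning
        c′ = c ∸ 1
        c≡ : suc c′ ≡ c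
        c≡ = m+[n∸m]≡n (>-nonZero⁻¹ c)
        lem₁ : ∀ b x n c′ → b * (x * (n * c′)) + n * suc c′ ≡ n + (1 + x * b) * n * c′
        lem₁ = solve-∀
        lem₂ : ∀ y c n c′ → n + y * c * n * c′ ≡ n + y * n * c′ * c
        lem₂ = solve-∀
    ... | l , eq = l % c , m%n<n l c , trans (*-reduce-% l) eq

-- Differences of natural numbers as integers

[m+n]-n≡m : ∀ m n → + (m + n) ℤ.- + n ≡ + m
[m+n]-n≡m m n = trans (ℤ.m-n≡m⊖n (m + n) n)
  (trans (ℤ.⊖-≥ (m≤n+m n m)) (cong +_ (m+n∸n≡m m n)))

m-n≡k⇒m≡k+n : ∀ m n k → + m ℤ.- + n ≡ + k → m ≡ k + n
m-n≡k⇒m≡k+n m n k eq = ℤ.+-injective (begin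
  + m                       ≡⟨ lem (+ m) (+ n) ⟩
  (+ m ℤ.- + n) ℤ.+ + n     ≡⟨ cong (ℤ._+ + n) eq ⟩
  + (k + n) ∎)
  where
  open ≡-Reasoning
  lem : ∀ i j → i ≡ (i ℤ.- j) ℤ.+ j
  lem = ℤ-Solver.solve-∀

m+n≤k⇒m≤k-n : ∀ {m n k} → m + n ≤ k → + m ℤ.≤ + k ℤ.- + n
m+n≤k⇒m≤k-n {m} {n} {k} le = subst (ℤ._≤ + k ℤ.- + n) ([m+n]-n≡m m n) (ℤ.+-monoˡ-≤ (ℤ.- + n) (ℤ.+≤+ le))

n∸1≤k⇒-1≤k-n : ∀ {n k} .{{_ : NonZero n}} → n ∸ 1 ≤ k → -[1+ 0 ] ℤ.≤ + k ℤ.- + n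
n∸1≤k⇒-1≤k-n {suc n} {k} le = subst (ℤ._≤ + k ℤ.- + suc n) eq (ℤ.+-monoˡ-≤ (ℤ.- + suc n) (ℤ.+≤+ le))
  where
  lem : ∀ i → i ℤ.- (+ 1 ℤ.+ i) ≡ -[1+ 0 ]
  lem = ℤ-Solver.solve-∀
  eq : + n ℤ.- + suc n ≡ -[1+ 0 ]
  eq = lem (+ n)

-- Sums over finite ranges and residues

sum-const : ∀ n k → ∑[ i < n ] k ≡ n * k
sum-const zero    k = refl
sum-const (suc n) k = cong (_+_ k) (sum-const n k)

sum-reverse : ∀ n (f : Fin n → ℕ) → ∑[ i < n ] f i ≡ ∑[ i < n ] f (opposite i)
sum-reverse n f = Sum.∑-permute f Permutation.reverse

length-concat-tabulate : ∀ {A : Set} n (f : Fin n → List A) →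
                         length (concat (tabulate f)) ≡ ∑[ i < n ] length (f i)
length-concat-tabulate zero    f = refl
length-concat-tabulate (suc n) f =
  trans (length-++ (f zero)) (cong (_+_ (length (f zero))) (length-concat-tabulate n (f ∘ suc)))

module _ {b c : ℕ} .{{_ : NonZero c}} (b⊥c : Coprime b c) where

  -- The sum is divisible by c and lies strictly between 0 and 2 c.
  residue-complement : ∀ {l l′} → 0 < l → l < c → l′ + l ≡ c →
                       (b * l) % c + (b * l′) % c ≡ c
  residue-complement {l} {l′} 0<l l<c l+l′ = only-multiple (m%n≡0⇒n∣m _ c sum%)
    where
    r  = (b * l) % c
    r′ = (b * l′) % c
    sum% : (r + r′) % c ≡ 0
    sum% = begin
      (r + r′) % c            ≡⟨ %-distribˡ-+ (b * l) (b * l′) c ⟨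
      (b * l + b * l′) % c    ≡⟨ cong (_% c) (trans (sym (*-distribˡ-+ b l l′)) (cong (b *_) (trans (+-comm l l′) l+l′))) ⟩
      (b * c) % c             ≡⟨ m*n%n≡0 b c ⟩
      0 ∎
      where open ≡-Reasoning
    r≢0 : r ≢ 0
    r≢0 r≡0 = contradiction l≡0 (m<n⇒n≢0 0<l)
      where
      l≡0 : l ≡ 0
      l≡0 = begin
        l      ≡⟨ m<n⇒m%n≡m l<c ⟨
        l % c  ≡⟨ *-cancelˡ-% b⊥c l 0 (trans r≡0 (sym (trans (cong (_% c) (*-zeroʳ b)) (m*n%n≡0 0 c)))) ⟩
        0 % c  ≡⟨ m*n%n≡0 0 c ⟩
        0 ∎
        where open ≡-Reasoning
    only-multiple : c ∣ r + r′ → r + r′ ≡ c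
    only-multiple (divides 0 eq) = contradiction (m+n≡0⇒m≡0 r eq) r≢0
    only-multiple (divides 1 eq) = trans eq (*-identityˡ c)
    only-multiple (divides (suc (suc q)) eq) = contradiction eq (<⇒≢ (<-≤-trans
      (+-mono-< (m%n<n (b * l) c) (m%n<n (b * l′) c))
      (+-monoʳ-≤ c (m≤m+n c (q * c)))))

  private
    1+[c∸1] : suc (c ∸ 1) ≡ c
    1+[c∸1] = m+[n∸m]≡n (>-nonZero⁻¹ c)

  suc-toℕ< : (i : Fin (c ∸ 1)) → suc (toℕ i) < c
  suc-toℕ< i = subst (suc (toℕ i) <_) 1+[c∸1] (s<s (toℕ<n i))

  -- Pairing l with c - l, as in Gauss's summation.
  sum-residues : 2 * ∑[ i < c ∸ 1 ] ((b * suc (toℕ i)) % c) ≡ (c ∸ 1) * c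
  sum-residues = begin
    2 * Σ                                       ≡⟨ cong (_+_ Σ) (+-identityʳ Σ) ⟩
    Σ + Σ                                       ≡⟨ cong (_+_ Σ) (sum-reverse (c ∸ 1) r) ⟩
    Σ + ∑[ i < c ∸ 1 ] r (opposite i)           ≡⟨ Sum.∑-distrib-+ {c ∸ 1} r (r ∘ opposite) ⟨
    ∑[ i < c ∸ 1 ] (r i + r (opposite i))       ≡⟨ Sum.sum-cong-≗ (λ i → residue-complement z<s (suc-toℕ< i) (complement i)) ⟩
    ∑[ i < c ∸ 1 ] c                            ≡⟨ sum-const (c ∸ 1) c ⟩
    (c ∸ 1) * c ∎
    where
    open ≡-Reasoning
    r : Fin (c ∸ 1) → ℕ
    r i = (b * suc (toℕ i)) % c
    Σ = ∑[ i < c ∸ 1 ] r i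
    complement : ∀ i → suc (toℕ (opposite i)) + suc (toℕ i) ≡ c
    complement i = trans (cong suc (trans (cong (_+ suc (toℕ i)) (opposite-prop i)) (m∸n+n≡m (toℕ<n i)))) 1+[c∸1]

  -- A semigroup from its minimal elements modulo c

  -- G is a semigroup containing c, and x l is its least element congruent to b l
  -- modulo c, for l < c.  The bound c - 1 <= x (c - 1) is needed only to compare
  -- the Frobenius number with negative integers.
  module AperySet
    (G : Pred ℕ 0ℓ) (c∈G : c ∈ G) (+-closed : ∀ {m n} → m ∈ G → n ∈ G → m + n ∈ G)
    (x : ℕ → ℕ)
    (x0≡0   : x 0 ≡ 0)
    (x∈G    : ∀ {l} → l < c → x l ∈ G)
    (x-res  : ∀ {l} → l < c → x l % c ≡ (b * l) % c)
    (x-min  : ∀ {l} → l < c → ∀ {y} → y ∈ G → y % c ≡ (b * l) % c → x l ≤ y)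
    (x-max  : ∀ {l} → l < c → x l ≤ x (c ∸ 1))
    (x-low  : c ∸ 1 ≤ x (c ∸ 1))
    where

    +*-closed : ∀ {y} k → y ∈ G → y + k * c ∈ G
    +*-closed {y} zero    y∈ = subst (_∈ G) (sym (+-identityʳ y)) y∈
    +*-closed {y} (suc k) y∈ = subst (_∈ G) (+-assoc y c (k * c)) (+*-closed k (+-closed y∈ c∈G))

    upward : ∀ {l n} → l < c → n % c ≡ x l % c → x l ≤ n → n ∈ G
    upward l<c eq le with k , refl ← %-≡⇒+ le (sym eq) = +*-closed k (x∈G l<c)

    below∉G : ∀ {l n} → l < c → n % c ≡ x l % c → n < x l → n ∉ G
    below∉G l<c eq n<x n∈ = <⇒≱ n<x (x-min l<c n∈ (trans eq (x-res l<c)))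

    class : ∀ n → ∃[ l ] l < c × n % c ≡ x l % c
    class n with l , l<c , eq ← *-surjective-% b⊥c n = l , l<c , trans (sym eq) (sym (x-res l<c))

    x-c∉G : ∀ {l} → l < c → ¬ ((+ x l ℤ.- + c) ∈ᶻ G)
    x-c∉G {l} l<c (n , eq , n∈) = below∉G l<c
      (trans (sym ([m+n]%n≡m%n n c)) (cong (_% c) (sym x≡))) (subst (n <_) (sym x≡) (m<m+n n (>-nonZero⁻¹ c))) n∈
      where
      x≡ : x l ≡ n + c
      x≡ = m-n≡k⇒m≡k+n (x l) c n eq

    apery : Ap G c ≐ (λ e → ∃[ l ] l < c × e ≡ x l)
    apery = to , λ where (l , l<c , refl) → x∈G l<c , x-c∉G l<c
      where
      to : ∀ {e} → e ∈ Ap G c → ∃[ l ] l < c × e ≡ x l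
      to {e} (e∈ , e-c∉) with l , l<c , eq ← class e
        with %-≡⇒+ (x-min l<c e∈ (trans eq (x-res l<c))) (sym eq)
      ... | zero  , e≡ = l , l<c , trans e≡ (+-identityʳ (x l))
      ... | suc k , e≡ = contradiction (x l + k * c , e-c≡ , +*-closed k (x∈G l<c)) e-c∉
        where
        e-c≡ : + e ℤ.- + c ≡ + (x l + k * c)
        e-c≡ = trans (cong (λ z → + z ℤ.- + c) (trans e≡ (x∙yz≈xz∙y +-commutativeSemigroup (x l) c (k * c)))) ([m+n]-n≡m (x l + k * c) c)

    frobenius : IsFrobenius G (+ x (c ∸ 1) ℤ.- + c)
    frobenius = x-c∉G (≤-reflexive 1+[c∸1]) , largest
      where
      largest : ∀ z → ¬ (z ∈ᶻ G) → z ℤ.≤ + x (c ∸ 1) ℤ.- + c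
      largest -[1+ n ] _  = ℤ.≤-trans (ℤ.-≤- z≤n) (n∸1≤k⇒-1≤k-n x-low)
      largest (+ n)    n∉ with l , l<c , eq ← class n =
        m+n≤k⇒m≤k-n (≤-trans (%-≡∧<⇒+≤ (≰⇒> λ le → n∉ (n , refl , upward l<c eq le)) eq) (x-max l<c))

    -- The gaps congruent to b l.
    block : ℕ → List ℕ
    block l = applyUpTo (λ i → x l % c + i * c) (x l / c)

    block⁻ : ∀ {n} l → n ∈ˡ block l → n % c ≡ x l % c × n < x l
    block⁻ l n∈ with i , i<q , refl ← ∈-applyUpTo⁻ (λ i → x l % c + i * c) n∈ =
      trans ([m+kn]%n≡m%n (x l % c) i c) (m%n%n≡m%n (x l) c) ,
      (begin-strict
        x l % c + i * c        <⟨ +-monoʳ-< (x l % c) (*-monoˡ-< c i<q) ⟩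
        x l % c + x l / c * c  ≡⟨ m≡m%n+[m/n]*n (x l) c ⟨
        x l ∎)
      where open ≤-Reasoning

    block⁺ : ∀ {n} l → n % c ≡ x l % c → n < x l → n ∈ˡ block l
    block⁺ {n} l eq n<x = subst (_∈ˡ block l) (sym n≡)
      (∈-applyUpTo⁺ (λ i → x l % c + i * c) (*-cancelʳ-< c (n / c) (x l / c) (+-cancelˡ-< (x l % c) _ _
        (subst₂ _<_ n≡ (m≡m%n+[m/n]*n (x l) c) n<x))))
      where
      n≡ : n ≡ x l % c + n / c * c
      n≡ = trans (m≡m%n+[m/n]*n n c) (cong (_+ n / c * c) eq)

    block-unique : ∀ l → Unique (block l)
    block-unique l = Unique.applyUpTo⁺₁ _ (x l / c) λ i<j _ eq →
      <⇒≢ i<j (*-cancelʳ-≡ _ _ c (+-cancelˡ-≡ (x l % c) _ _ eq))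

    -- The class l = 0 is left out: it contains no gaps, as x 0 = 0.
    blocks : Fin (c ∸ 1) → List ℕ
    blocks i = block (suc (toℕ i))

    gaps : List ℕ
    gaps = concat (tabulate blocks)

    gaps-unique : Unique gaps
    gaps-unique = Unique.concat⁺ (ListAll.tabulate⁺ (λ i → block-unique (suc (toℕ i))))
      (AllPairs.tabulate⁺ λ {i} {j} i≢j (n∈i , n∈j) → i≢j (toℕ-injective (suc-injective (begin
        suc (toℕ i)      ≡⟨ m<n⇒m%n≡m (suc-toℕ< i) ⟨
        suc (toℕ i) % c  ≡⟨ *-cancelˡ-% b⊥c (suc (toℕ i)) (suc (toℕ j)) (trans (sym (res i n∈i)) (res j n∈j)) ⟩
        suc (toℕ j) % c  ≡⟨ m<n⇒m%n≡m (suc-toℕ< j) ⟩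
        suc (toℕ j) ∎))))
      where
      open ≡-Reasoning
      res : ∀ i {n} → n ∈ˡ blocks i → n % c ≡ (b * suc (toℕ i)) % c
      res i n∈ = trans (proj₁ (block⁻ (suc (toℕ i)) n∈)) (x-res (suc-toℕ< i))

    gaps⁻ : ∀ {n} → n ∈ˡ gaps → n ∉ G
    gaps⁻ n∈ with ns , n∈ns , ns∈ ← ∈-concat⁻′ (tabulate blocks) n∈
      with i , refl ← ∈-tabulate⁻ ns∈
      with eq , n<x ← block⁻ (suc (toℕ i)) n∈ns = below∉G (suc-toℕ< i) eq n<x

    gaps⁺ : ∀ {n} → n ∉ G → n ∈ˡ gaps
    gaps⁺ {n} n∉ with class n
    ... | zero , l<c , eq = contradiction (upward l<c eq (subst (_≤ n) (sym x0≡0) z≤n)) n∉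
    ... | suc l , l<c , eq =
      ∈-concat⁺′ (subst (λ z → n ∈ˡ block (suc z)) (sym (toℕ-fromℕ< l<))
                   (block⁺ (suc l) eq (≰⇒> λ le → n∉ (upward l<c eq le))))
                 (∈-tabulate⁺ (fromℕ< l<))
      where
      l< : l < c ∸ 1
      l< = ≤-pred (subst (suc l <_) (sym 1+[c∸1]) l<c)

    isGenus : IsGenus G (length gaps)
    isGenus = gaps , gaps-unique , (λ n → mk⇔ gaps⁻ gaps⁺) , refl

    genus-formula : 2 * (c * length gaps) + (c ∸ 1) * c ≡ 2 * ∑[ i < c ∸ 1 ] x (suc (toℕ i))
    genus-formula = begin
      2 * (c * length gaps) + (c ∸ 1) * c  ≡⟨ cong (λ z → 2 * (c * length gaps) + z) sum-residues ⟨
      2 * (c * length gaps) + 2 * ∑[ i < c ∸ 1 ] ((b * suc (toℕ i)) % c)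
        ≡⟨ *-distribˡ-+ 2 (c * length gaps) _ ⟨
      2 * (c * length gaps + ∑[ i < c ∸ 1 ] ((b * suc (toℕ i)) % c))
        ≡⟨ cong (2 *_) (trans (cong₂ _+_ c*length (Sum.sum-cong-≗ (λ i → sym (x-res (suc-toℕ< i))))) (sym (Sum.∑-distrib-+ {c ∸ 1} _ _))) ⟩
      2 * ∑[ i < c ∸ 1 ] (x (suc (toℕ i)) / c * c + x (suc (toℕ i)) % c)
        ≡⟨ cong (2 *_) (Sum.sum-cong-≗ {c ∸ 1} (λ i → trans (+-comm (x (suc (toℕ i)) / c * c) _) (sym (m≡m%n+[m/n]*n (x (suc (toℕ i))) c)))) ⟩
      2 * ∑[ i < c ∸ 1 ] x (suc (toℕ i)) ∎
      where
      open ≡-Reasoning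
      c*length : c * length gaps ≡ ∑[ i < c ∸ 1 ] (x (suc (toℕ i)) / c * c)
      c*length = begin
        c * length gaps ≡⟨ *-comm c _ ⟩
        length gaps * c ≡⟨ cong (_* c) (trans (length-concat-tabulate (c ∸ 1) blocks) (Sum.sum-cong-≗ {c ∸ 1} (λ i → length-applyUpTo _ (x (suc (toℕ i)) / c)))) ⟩
        ∑[ i < c ∸ 1 ] (x (suc (toℕ i)) / c) * c ≡⟨ *-distribʳ-sum +-*-semiring {c ∸ 1} c _ ⟩
        ∑[ i < c ∸ 1 ] (x (suc (toℕ i)) / c * c) ∎

-- The genus formula with denominators, from its form over the natural numbers.
rational-form : ∀ c .{{_ : NonZero c}} g X → 2 * (c * g) + (c ∸ 1) * c ≡ 2 * X →
                + g ℚ./ 1 ≡ (+ 1 ℚ./ c) ℚ.* (+ X ℚ./ 1) ℚ.- + (c ∸ 1) ℚ./ 2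
rational-form (suc c′) g X eq = ℚ.toℚᵘ-injective (begin
  ℚ.toℚᵘ (+ g ℚ./ 1)           ≈⟨ ℚ.toℚᵘ-fromℚᵘ (ℚᵘ.mkℚᵘ (+ g) 0) ⟩
  ℚᵘ.mkℚᵘ (+ g) 0              ≈⟨ ℚᵘ.*≡* cross ⟩
  ℚᵘ.mkℚᵘ (+ 1) c′ ℚᵘ.* ℚᵘ.mkℚᵘ (+ X) 0 ℚᵘ.- ℚᵘ.mkℚᵘ (+ c′) 1
    ≈⟨ ℚᵘ.+-cong (ℚᵘ.*-cong (ℚ.toℚᵘ-fromℚᵘ (ℚᵘ.mkℚᵘ (+ 1) c′)) (ℚ.toℚᵘ-fromℚᵘ (ℚᵘ.mkℚᵘ (+ X) 0)))
                 (ℚᵘ.-‿cong (ℚ.toℚᵘ-fromℚᵘ (ℚᵘ.mkℚᵘ (+ c′) 1))) ⟨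
  ℚ.toℚᵘ p ℚᵘ.* ℚ.toℚᵘ q ℚᵘ.- ℚ.toℚᵘ r
    ≈⟨ ℚᵘ.+-cong (ℚ.toℚᵘ-homo-* p q) (ℚ.toℚᵘ-homo‿- r) ⟨
  ℚ.toℚᵘ (p ℚ.* q) ℚᵘ.+ ℚ.toℚᵘ (ℚ.- r)
    ≈⟨ ℚ.toℚᵘ-homo-+ (p ℚ.* q) (ℚ.- r) ⟨
  ℚ.toℚᵘ (p ℚ.* q ℚ.- r) ∎)
  where
  open ℚᵘ.≃-Reasoning
  p = + 1 ℚ./ suc c′
  q = + X ℚ./ 1
  r = + c′ ℚ./ 2
  cross : + g ℤ.* + (suc c′ * 1 * 2) ≡ ((+ 1 ℤ.* + X) ℤ.* + 2 ℤ.+ (ℤ.- + c′) ℤ.* + (suc c′ * 1)) ℤ.* + 1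
  cross = trans (cong (+ g ℤ.*_) denominator) (trans (lem₁ (+ g) (+ c′)) (trans
    (cong (λ z → z ℤ.- + c′ ℤ.* (+ 1 ℤ.+ + c′)) eqℤ)
    (trans (lem₂ (+ c′) (+ X)) (cong (λ z → ((+ 1 ℤ.* + X) ℤ.* + 2 ℤ.+ (ℤ.- + c′) ℤ.* z) ℤ.* + 1) (sym (ℤ.pos-* (suc c′) 1))))))
    where
    denominator : + (suc c′ * 1 * 2) ≡ (+ 1 ℤ.+ + c′) ℤ.* + 1 ℤ.* + 2
    denominator = trans (ℤ.pos-* (suc c′ * 1) 2) (cong (ℤ._* + 2) (ℤ.pos-* (suc c′) 1))
    eqℤ : + 2 ℤ.* ((+ 1 ℤ.+ + c′) ℤ.* + g) ℤ.+ + c′ ℤ.* (+ 1 ℤ.+ + c′) ≡ + 2 ℤ.* + X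
    eqℤ = trans (sym (cong₂ ℤ._+_ (trans (ℤ.pos-* 2 (suc c′ * g)) (cong (+ 2 ℤ.*_) (ℤ.pos-* (suc c′) g)))
                                  (ℤ.pos-* c′ (suc c′))))
                (trans (cong +_ eq) (ℤ.pos-* 2 X))
    lem₁ : ∀ g c′ → g ℤ.* ((+ 1 ℤ.+ c′) ℤ.* + 1 ℤ.* + 2) ≡
           (+ 2 ℤ.* ((+ 1 ℤ.+ c′) ℤ.* g) ℤ.+ c′ ℤ.* (+ 1 ℤ.+ c′)) ℤ.- c′ ℤ.* (+ 1 ℤ.+ c′)
    lem₁ = ℤ-Solver.solve-∀
    lem₂ : ∀ c′ X → + 2 ℤ.* X ℤ.- c′ ℤ.* (+ 1 ℤ.+ c′) ≡
           ((+ 1 ℤ.* X) ℤ.* + 2 ℤ.+ (ℤ.- c′) ℤ.* ((+ 1 ℤ.+ c′) ℤ.* + 1)) ℤ.* + 1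
    lem₂ = ℤ-Solver.solve-∀

-- The minimal elements of the generated semigroup

-- Some expansion has second component l and first component e, and e is a lower
-- bound for the first component whenever the second is at least l.
record Optimal (a e l : ℕ) : Set where
  field
    expansion : Expansion a e l
    minimal   : ∀ {E L} → Expansion a E L → l ≤ L → e ≤ E

Represents⇒Optimal : ∀ {a l} .{{_ : NonZero a}} {J : Family} → Represents a l J →
                     Optimal a (pval a (0 ∷ proj₂ J)) l
Represents⇒Optimal {a} {l} {_ , j} (r , l≡) = record
  { expansion = subst (Expansion a _) sval≡l (expand a (0 ∷ j))
  ; minimal   = λ p l≤L → pval-minimal (Reduced⇒Red r) p (≤-trans (≤-reflexive sval≡l) l≤L)
  }
  where
  sval≡l : sval a (0 ∷ j) ≡ l
  sval≡l = sym (trans l≡ (digitSum-s a (0 ∷ j)))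

-- J attaches a reduced family to each l with 0 < l < c.
module MinimalElements (a b c : ℕ) .{{_ : NonZero a}} .{{_ : NonZero b}} .{{_ : NonZero c}} (b⊥c : Coprime b c)
  (J : ℕ → Family) (rep : ∀ l → 1 ≤ l → l < c → Represents a l (J l))
  where

  private
    G = ⟨ a , b ⟩ c
    x = x[ a , b , c ] J

  x∈G : ∀ l → x l ∈ G
  x∈G zero    = zero
  x∈G (suc l) = sum-closed _ (λ i → lookup j i * t a b c (suc (toℕ i)))
                                λ i → *-closed (lookup j i) (t∈G (suc (toℕ i)))
    where j = proj₂ (J (suc l))

  x-optimal : ∀ {l} → l < c → ∃[ e ] Optimal a e l × x l ≡ c * e + b * l
  x-optimal {zero}  _   = 0 , record { expansion = [] ; minimal = λ _ _ → z≤n } ,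
                          sym (cong₂ _+_ (*-zeroʳ c) (*-zeroʳ b))
  x-optimal {suc l} l<c = _ , Represents⇒Optimal r , (begin
    digitSum (0 ∷ j) (t a b c)                   ≡⟨ digitSum-t a b c (0 ∷ j) ⟩
    c * pval a (0 ∷ j) + b * sval a (0 ∷ j)
      ≡⟨ cong (λ z → c * pval a (0 ∷ j) + b * z) (trans (proj₂ r) (digitSum-s a (0 ∷ j))) ⟨
    c * pval a (0 ∷ j) + b * suc l               ∎)
    where
    open ≡-Reasoning
    j = proj₂ (J (suc l))
    r = rep (suc l) z<s l<c

  [c*m+n]%c≡n%c : ∀ m n → (c * m + n) % c ≡ n % c
  [c*m+n]%c≡n%c m n = trans (cong (_% c) (trans (+-comm (c * m) n) (cong (_+_ n) (*-comm c m)))) ([m+kn]%n≡m%n n m c)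

  x-res : ∀ {l} → l < c → x l % c ≡ (b * l) % c
  x-res {l} l<c with e , _ , x≡ ← x-optimal l<c = trans (cong (_% c) x≡) ([c*m+n]%c≡n%c e (b * l))

  x-min : ∀ {l} → l < c → ∀ {y} → y ∈ G → y % c ≡ (b * l) % c → x l ≤ y
  x-min {l} l<c y∈ eq with e , opt , x≡ ← x-optimal l<c with E , L , p , refl ← ∈⇒Expansion y∈ =
    ≤-trans (≤-reflexive x≡) (+-mono-≤ (*-monoʳ-≤ c (Optimal.minimal opt p l≤L)) (*-monoʳ-≤ b l≤L))
    where
    L%c≡l : L % c ≡ l
    L%c≡l = trans (*-cancelˡ-% b⊥c L l (trans (sym ([c*m+n]%c≡n%c E (b * L))) eq)) (m<n⇒m%n≡m l<c)
    l≤L : l ≤ L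
    l≤L = subst (_≤ L) L%c≡l (m%n≤m L c)

  c∸1<c : c ∸ 1 < c
  c∸1<c = ≤-reflexive (m+[n∸m]≡n (>-nonZero⁻¹ c))

  -- The expansion attached to c - 1 competes with the optimal one for l.
  x-max : ∀ {l} → l < c → x l ≤ x (c ∸ 1)
  x-max {l} l<c with e , opt , x≡ ← x-optimal l<c | e′ , opt′ , x≡′ ← x-optimal c∸1<c =
    subst₂ _≤_ (sym x≡) (sym x≡′)
      (+-mono-≤ (*-monoʳ-≤ c (Optimal.minimal opt (Optimal.expansion opt′) l≤)) (*-monoʳ-≤ b l≤))
    where
    l≤ : l ≤ c ∸ 1
    l≤ = <⇒≤pred l<c

  x-low : c ∸ 1 ≤ x (c ∸ 1)
  x-low with e , _ , x≡ ← x-optimal c∸1<c =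
    ≤-trans (m≤n*m (c ∸ 1) b) (≤-trans (m≤n+m (b * (c ∸ 1)) (c * e)) (≤-reflexive (sym x≡)))

  isMin : ∀ {l} → l < c → IsMin (λ y → y ∈ G × y ≡ b * l [mod c ]) (x l)
  isMin {l} l<c = (x∈G l , %⇒mod (x l) (b * l) (x-res l<c)) ,
                  λ {y} (y∈ , eq) → x-min l<c y∈ (mod⇒% y (b * l) eq)

  open AperySet b⊥c G gen add x refl (λ {l} _ → x∈G l) x-res x-min x-max x-low public

theorem3p4 :
  (a b c : ℕ) .{{_ : NonZero a}} .{{_ : NonZero b}} .{{_ : NonZero c}} →
  2 ≤ c → gcd b c ≡ 1 →
  (∀ l → 1 ≤ l → l ≤ c ∸ 1 → ∃! _≡_ (Represents a l))
  ×
  (∀ (J : ℕ → Family) →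
    (∀ l → 1 ≤ l → l ≤ c ∸ 1 → Represents a l (J l)) →
    let G = ⟨ a , b ⟩ c
        x = x[ a , b , c ] J
    in
    (∀ l → l ≤ c ∸ 1 → IsMin (λ y → y ∈ G × y ≡ b * l [mod c ]) (x l))
    × (Ap G c ≐ (λ e → ∃[ l ] l ≤ c ∸ 1 × e ≡ x l))
    × IsFrobenius G (+ x (c ∸ 1) ℤ.- + c)
    × (∃[ g ] IsGenus G g ×
        + g ℚ./ 1 ≡
          (+ 1 ℚ./ c) ℚ.* (+ (∑[ i < c ∸ 1 ] x (suc (toℕ i))) ℚ./ 1)
            ℚ.- + (c ∸ 1) ℚ./ 2))
theorem3p4 a b c@(suc c′) 2≤c gcd≡1 =
  (λ l 1≤l _ → ∃!-Represents a l 1≤l) ,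
  λ J rep →
    let open MinimalElements a b c (gcd≡1⇒coprime gcd≡1) J (λ l 1≤l l<c → rep l 1≤l (≤-pred l<c))
    in  (λ l l≤c′ → isMin (s≤s l≤c′))
      , ( (λ e∈ → let l , l<c , e≡ = proj₁ apery e∈ in l , ≤-pred l<c , e≡)
        , (λ (l , l≤c′ , e≡) → proj₂ apery (l , s≤s l≤c′ , e≡)))
      , frobenius
      , length gaps , isGenus , rational-form c (length gaps) (∑[ i < c′ ] x[ a , b , c ] J (suc (toℕ i))) genus-formula
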